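{- Let $\mathcal G,\mathcal G'$ be two parity games with vertex sets $V,V'$, and let $\mathcal G_q=(V_{/\equiv_d},\to_q,\Omega_q,\mathcal P_q)$ and $\mathcal G'_q=(V'_{/\equiv_d},\to'_q,\Omega'_q,\mathcal P'_q)$ be their direct simulation equivalence quotients, respectively. Then $\mathcal G\equiv_d\mathcal G'$ if and only if the two structures $\mathcal G_q$ and $\mathcal G'_q$ are isomorphic.
   Context: A parity game is a tuple $(V,\to,\Omega,\mathcal P)$ where $V$ is a finite set of vertices, $\to\subseteq V\times V$ is total (every vertex has at least one successor), $\Omega:V\to\mathbb N$ is a priority function, and $\mathcal P:V\to\{\Diamond,\Box\}$ assigns each vertex to player even ($\Diamond$) or odd ($\Box$). Write $V_\Diamond,V_\Box$ for the vertices owned by each player and $v^\bullet=\{w\mid v\to w\}$. One-step forcing: for $v\in V$, $T\subseteq V$ and a player $i$, $v\to_i T$ means: either $\mathcal P(v)=i$ and $v^\bullet\cap T\neq\emptyset$, or $\mathcal P(v)\neq i$ and $v^\bullet\subseteq T$. For $R\subseteq V\times V$ put $vR=\{w\mid v\,R\,w\}$ and $UR=\bigcup_{u\in U}uR$. $R\subseteq V\times V$ is a direct simulation iff $v\,R\,w$ implies: (1) $\Omega(v)=\Omega(w)$; (2) if $v\in V_\Diamond$ then for each $v'\in v^\bullet$, $w\to_\Diamond v'R$; (3) if $v\in V_\Box$ then $w\to_\Diamond v^\bullet R$. Write $v\leq_d w$ iff some direct simulation $R$ has $v\,R\,w$ (this is a preorder), and $v\equiv_d w$ iff $v\leq_d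 w$ and $w\leq_d v$. Write $[v]_{\equiv_d}$ for the class of $v$, $V_{/\equiv_d}$ for the set of classes, and $[V'']_{\equiv_d}=\{[v]_{\equiv_d}\mid v\in V''\}$ for $V''\subseteq V$. $\min_{\leq_d}(v)$ is the set of $v'\in v^\bullet$ that are minimal among $v^\bullet$, i.e. for all $u\in v^\bullet$, $u\leq_d v'$ implies $v'\leq_d u$. $\max_{\leq_d}(v)$ is the set of $v'\in v^\bullet$ that are maximal among $v^\bullet$, i.e. for all $u\in v^\bullet$, $v'\leq_d u$ implies $u\leq_d v'$. Direct simulation equivalence quotient of $(V,\to,\Omega,\mathcal P)$: the structure $(V_{/\equiv_d},\to_q,\Omega_q,\mathcal P_q)$ with, for classes $\mathcal C,\mathcal C'$: - $\Omega_q(\mathcal C)=\min\{\Omega(v)\mid v\in\mathcal C\}$; - $\mathcal P_q(\mathcal C)=\Box$ if $\mathcal C\subseteq V_\Box$ and $|[\min_{\leq_d}(u)]_{\equiv_d}|>1$ for all $u\in\mathcal C$; $\mathcal P_q(\mathcal C)=\Diamond$ otherwise; - $\mathcal C\to_q\mathcal C'$ iff: in case $\mathcal C\subseteq V_\Box$, for all $v\in\mathcal C$ there is $v'\in\min_{\leq_d}(v)$ with $v'\in\mathcal C'$; in the other case, for all $v\in\mathcal C\cap V_\Diamond$ there is $v'\in\max_{\leq_d}(v)$ with $v'\in\mathcal C'$. Equivalence of games: for parity games $\mathcal G_1,\mathcal G_2$ with vertex sets $V_1,V_2$ and a vertex equivalence $\sim$, $\mathcal G_1\sim\mathcal G_2$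 iff in the disjoint union of $\mathcal G_1$ and $\mathcal G_2$, every $v_1\in V_1$ has some $v_2\in V_2$ with $v_1\sim v_2$, and every $v_2\in V_2$ has some $v_1\in V_1$ with $v_1\sim v_2$. Two such structures are isomorphic iff there is a bijection between their vertex sets that preserves priorities and owners, and preserves and reflects edges. -}

module Defs where

open import Data.Bool.Base using (if_then_else_)
open import Data.Empty using (⊥-elim)
open import Data.Fin.Base as Fin using (Fin; combine; remQuot)
import Data.Fin.Properties as Fin
open import Data.Fin.Subset as Subset using (Subset; inside; outside)
open import Data.Fin.Subset.Properties using (anySubset?; _∈?_)
open import Data.List.Base using (List; map; filter; length; deduplicate; allFin)
open import Data.List.Extrema.Nat using (min)
open import Data.List.Properties using (filter-≐)
open import Data.Nat.Base as ℕ using (ℕ; _>_)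
import Data.Nat.Properties as ℕ
open import Data.Product.Base using (Σ-syntax; ∃; _×_; _,_; proj₁; proj₂)
open import Data.Sum.Base using (_⊎_; inj₁; inj₂; [_,_]′)
open import Data.Sum.Function.Propositional using (_⊎-↔_)
open import Data.Sum.Relation.Binary.Pointwise
  using (Pointwise; inj₁; inj₂; ⊎-decidable)
open import Data.Vec.Base using ([]; _∷_; here; there)
open import Function.Base using (_∘_)
open import Function.Bundles
  using (_⇔_; mk⇔; _↔_; Inverse; Equivalence; Bijection)
open import Function.Construct.Composition using (_↔-∘_)
open import Function.Construct.Symmetry using (↔-sym)
open import Level using (Level; 0ℓ; suc)
open import Relation.Binary.Bundles using (Setoid)
open import Relation.Binary.Core using (Rel; _⇒_)
open import Relation.Binary.Definitions as Binary using (DecidableEquality)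
open import Relation.Binary.PropositionalEquality hiding ([_])
open import Relation.Nullary.Decidable
  using (Dec; yes; no; does; map′; does-⇔; ¬?; _×-dec_; _⊎-dec_; _→-dec_;
         ¬¬-excluded-middle)
open import Relation.Nullary.Negation using (¬_)
open import Relation.Unary using (Pred; Decidable; _∈_; _⊆_; _≬_)

private
  variable
    ℓ ℓ′ : Level

data Player : Set where
  ◇ □ : Player

_≟ᴾ_ : DecidableEquality Player
◇ ≟ᴾ ◇ = yes refl
◇ ≟ᴾ □ = no λ ()
□ ≟ᴾ ◇ = no λ ()
□ ≟ᴾ □ = yes refl

-- The edge relation is a subset of the finite set V × V, hence decidable.
record ParityGame : Set₁ where
  infix 4 _⟶_ _⟶?_
  field
    V      : Set
    size   : ℕ
    finite : V ↔ Fin size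
    _⟶_    : Rel V 0ℓ
    _⟶?_   : Binary.Decidable _⟶_
    total  : ∀ v → ∃ λ w → v ⟶ w
    Ω      : V → ℕ
    𝒫      : V → Player

infixr 5 _⊎ᴳ_

_⊎ᴳ_ : ParityGame → ParityGame → ParityGame
G ⊎ᴳ H = record
  { V      = G.V ⊎ H.V
  ; size   = G.size ℕ.+ H.size
  ; finite = ↔-sym Fin.+↔⊎ ↔-∘ (G.finite ⊎-↔ H.finite)
  ; _⟶_    = Pointwise G._⟶_ H._⟶_
  ; _⟶?_   = ⊎-decidable G._⟶?_ H._⟶?_
  ; total  = λ
    { (inj₁ v) → let w , v⟶w = G.total v in inj₁ w , inj₁ v⟶w
    ; (inj₂ v) → let w , v⟶w = H.total v in inj₂ w , inj₂ v⟶w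
    }
  ; Ω      = [ G.Ω , H.Ω ]′
  ; 𝒫      = [ G.𝒫 , H.𝒫 ]′
  }
  where
  module G = ParityGame G
  module H = ParityGame H

module Game (G : ParityGame) where
  open ParityGame G public

  infix 10 _•
  infix 9 _[_]
  infix 4 _⟶⟨_⟩_

  index : V → Fin size
  index = Inverse.to finite

  vertex : Fin size → V
  vertex = Inverse.from finite

  vertex-index : ∀ v → vertex (index v) ≡ v
  vertex-index = Inverse.strictlyInverseʳ finite

  vertices : List V
  vertices = map vertex (allFin size)

  all? : {P : Pred V ℓ} → Decidable P → Dec (∀ v → P v)
  all? {P = P} P? = map′ (λ h v → subst P (vertex-index v) (h (index v)))
                         (λ h i → h (vertex i))
                         (Fin.all? (P? ∘ vertex))

  any? : {P : Pred V ℓ} → Decidable P → Dec (∃ P)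
  any? {P = P} P? =
    map′ (λ (i , p) → vertex i , p)
         (λ (v , p) → index v , subst P (sym (vertex-index v)) p)
         (Fin.any? (P? ∘ vertex))

  ⊆? : {P : Pred V ℓ} {Q : Pred V ℓ′} → Decidable P → Decidable Q → Dec (P ⊆ Q)
  ⊆? P? Q? = map′ (λ h {v} → h v) (λ h v → h {v})
                  (all? λ v → P? v →-dec Q? v)

  V⟨_⟩ : Player → Pred V 0ℓ
  V⟨ i ⟩ v = 𝒫 v ≡ i

  V⟨_⟩? : ∀ i → Decidable V⟨ i ⟩
  V⟨ i ⟩? v = 𝒫 v ≟ᴾ i

  _• : V → Pred V 0ℓ
  v • = v ⟶_

  _[_] : Pred V ℓ → Rel V ℓ′ → Pred V _
  (U [ R ]) w = ∃ λ u → u ∈ U × R u w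

  _⟶⟨_⟩_ : V → Player → Pred V ℓ → Set ℓ
  v ⟶⟨ i ⟩ T = (𝒫 v ≡ i × v • ≬ T) ⊎ (𝒫 v ≢ i × v • ⊆ T)

  ⟶⟨⟩? : {T : Pred V ℓ} → Decidable T → ∀ v i → Dec (v ⟶⟨ i ⟩ T)
  ⟶⟨⟩? T? v i = (𝒫 v ≟ᴾ i ×-dec any? λ w → v ⟶? w ×-dec T? w)
          ⊎-dec (¬? (𝒫 v ≟ᴾ i) ×-dec ⊆? (v ⟶?_) T?)

  ⟶⟨⟩-mono : ∀ {v i} {T : Pred V ℓ} {U : Pred V ℓ′} →
             T ⊆ U → v ⟶⟨ i ⟩ T → v ⟶⟨ i ⟩ U
  ⟶⟨⟩-mono T⊆U (inj₁ (p , w , e , t)) = inj₁ (p , w , e , T⊆U t)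
  ⟶⟨⟩-mono T⊆U (inj₂ (p , h))         = inj₂ (p , λ e → T⊆U (h e))

module DirectSimulation (G : ParityGame) where
  open Game G

  infix 4 _≤ᵈ_ _≤ᵈ?_ _≡ᵈ_ _≡ᵈ?_

  IsDirectSimulation : Pred (Rel V 0ℓ) 0ℓ
  IsDirectSimulation R = ∀ {v w} → R v w →
      Ω v ≡ Ω w
    × (v ∈ V⟨ ◇ ⟩ → ∀ {v′} → v′ ∈ v • → w ⟶⟨ ◇ ⟩ R v′)
    × (v ∈ V⟨ □ ⟩ → w ⟶⟨ ◇ ⟩ v • [ R ])

  _≤ᵈ_ : Rel V (suc 0ℓ)
  v ≤ᵈ w = Σ[ R ∈ Rel V 0ℓ ] IsDirectSimulation R × R v w

  _≡ᵈ_ : Rel V (suc 0ℓ)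
  v ≡ᵈ w = v ≤ᵈ w × w ≤ᵈ v

  ≤ᵈ-refl : ∀ {v} → v ≤ᵈ v
  ≤ᵈ-refl = _≡_ , sim , refl
    where
    sim : IsDirectSimulation _≡_
    sim {v} refl =
        refl
      , (λ ◇v {v′} e → inj₁ (◇v , v′ , e , refl))
      , (λ □v → inj₂ ( (λ ◇v → □≢◇ (trans (sym □v) ◇v))
                     , λ {v′} e → v′ , e , refl))
      where
      □≢◇ : □ ≢ ◇
      □≢◇ ()

  ≤ᵈ-trans : ∀ {u v w} → u ≤ᵈ v → v ≤ᵈ w → u ≤ᵈ w
  ≤ᵈ-trans {u} {v} {w} (R , simR , uRv) (S , simS , vSw) =
    R⨾S , sim , v , uRv , vSw
    where
    R⨾S : Rel V 0ℓ
    R⨾S x z = ∃ λ y → R x y × S y z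

    force : ∀ {y z} {T : Pred V 0ℓ} →
            S y z → y ⟶⟨ ◇ ⟩ T → z ⟶⟨ ◇ ⟩ T [ S ]
    force ySz (inj₁ (◇y , y′ , e , t)) =
      ⟶⟨⟩-mono (λ s → y′ , t , s) (proj₁ (proj₂ (simS ySz)) ◇y e)
    force {y} ySz (inj₂ (¬◇y , h)) =
      ⟶⟨⟩-mono (λ (y′ , e , s) → y′ , h e , s)
               (proj₂ (proj₂ (simS ySz)) (odd (𝒫 y) ¬◇y))
      where
      odd : ∀ p → p ≢ ◇ → p ≡ □
      odd ◇ p≢◇ = ⊥-elim (p≢◇ refl)
      odd □ _   = refl

    sim : IsDirectSimulation R⨾S
    sim (y , xRy , ySz) with simR xRy
    ... | Ω≡ , even , odd =
        trans Ω≡ (proj₁ (simS ySz))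
      , (λ ◇x e → force ySz (even ◇x e))
      , (λ □x → ⟶⟨⟩-mono (λ (y′ , (x′ , e , r) , s) → x′ , e , y′ , r , s)
                         (force ySz (odd □x)))

  ≡ᵈ-setoid : Setoid 0ℓ (suc 0ℓ)
  ≡ᵈ-setoid = record
    { Carrier       = V
    ; _≈_           = _≡ᵈ_
    ; isEquivalence = record
      { refl  = ≤ᵈ-refl , ≤ᵈ-refl
      ; sym   = λ (p , q) → q , p
      ; trans = λ (p , q) (p′ , q′) → ≤ᵈ-trans p p′ , ≤ᵈ-trans q′ q
      }
    }

  open Setoid ≡ᵈ-setoid public
    using () renaming (refl to ≡ᵈ-refl; sym to ≡ᵈ-sym; trans to ≡ᵈ-trans)

  -- ≤ᵈ is decided by searching the finitely many bit-coded relations on V.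
  -- An arbitrary R need not be decidable, but it is not not equal to a coded
  -- relation, which suffices to refute v ≤ᵈ w when the search fails.
  private
    ⟦_⟧ : Subset (size ℕ.* size) → Rel V 0ℓ
    ⟦ S ⟧ v w = combine (index v) (index w) Subset.∈ S

    ⟦_⟧? : ∀ S → Binary.Decidable ⟦ S ⟧
    ⟦ S ⟧? v w = combine (index v) (index w) ∈? S

    simulation? : ∀ S → Dec (IsDirectSimulation ⟦ S ⟧)
    simulation? S = map′ (λ h {v} {w} → h v w) (λ h v w → h {v} {w})
      (all? λ v → all? λ w → ⟦ S ⟧? v w →-dec
        (Ω v ℕ.≟ Ω w
        ×-dec (V⟨ ◇ ⟩? v →-dec map′ (λ h {v′} → h v′) (λ h v′ → h {v′})
                (all? λ v′ → v ⟶? v′ →-dec ⟶⟨⟩? (⟦ S ⟧? v′) w ◇))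
        ×-dec (V⟨ □ ⟩? v →-dec
                ⟶⟨⟩? (λ x → any? λ u → v ⟶? u ×-dec ⟦ S ⟧? u x) w ◇)))

    ¬¬-coded : ∀ {n} (P : Pred (Fin n) 0ℓ) →
               ¬ ¬ (∃ λ S → ∀ k → k Subset.∈ S ⇔ P k)
    ¬¬-coded {ℕ.zero}  P c = c ([] , λ ())
    ¬¬-coded {ℕ.suc n} P c = ¬¬-coded (P ∘ Fin.suc) λ (S , S⇔P) →
      let step : ∀ k → Fin.suc k Subset.∈ (inside ∷ S) ⇔ P (Fin.suc k)
          step k = mk⇔ (λ { (there i) → Equivalence.to (S⇔P k) i })
                       (λ p → there (Equivalence.from (S⇔P k) p))
          step′ : ∀ k → Fin.suc k Subset.∈ (outside ∷ S) ⇔ P (Fin.suc k)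
          step′ k = mk⇔ (λ { (there i) → Equivalence.to (S⇔P k) i })
                        (λ p → there (Equivalence.from (S⇔P k) p))
      in ¬¬-excluded-middle λ
        { (yes p) → c (inside ∷ S , λ
          { Fin.zero    → mk⇔ (λ _ → p) (λ _ → here)
          ; (Fin.suc k) → step k })
        ; (no ¬p) → c (outside ∷ S , λ
          { Fin.zero    → mk⇔ (λ ()) (λ p → ⊥-elim (¬p p))
          ; (Fin.suc k) → step′ k })
        }

    simulation-resp : ∀ {R S : Rel V 0ℓ} → R ⇒ S → S ⇒ R →
                      IsDirectSimulation R → IsDirectSimulation S
    simulation-resp R⇒S S⇒R sim s with sim (S⇒R s)
    ... | Ω≡ , even , odd =
        Ω≡
      , (λ ◇v e → ⟶⟨⟩-mono R⇒S (even ◇v e))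
      , (λ □v → ⟶⟨⟩-mono (λ (u , e , r) → u , e , R⇒S r) (odd □v))

  _≤ᵈ?_ : Binary.Decidable _≤ᵈ_
  v ≤ᵈ? w with anySubset? (λ S → simulation? S ×-dec ⟦ S ⟧? v w)
  ... | yes (S , sim , s) = yes (⟦ S ⟧ , sim , s)
  ... | no none = no λ (R , sim , vRw) →
    ¬¬-coded (λ k → let i , j = remQuot size k in R (vertex i) (vertex j))
      λ (S , S⇔) →
        let decode : ∀ x y → (let i , j = remQuot size (combine (index x) (index y))
                              in R (vertex i) (vertex j)) ≡ R x y
            decode x y = trans
              (cong (λ (i , j) → R (vertex i) (vertex j))
                    (Fin.remQuot-combine (index x) (index y)))
              (cong₂ R (vertex-index x) (vertex-index y))
            R⇒S : R ⇒ ⟦ S ⟧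
            R⇒S {x} {y} r = Equivalence.from (S⇔ _)
                              (subst (λ A → A) (sym (decode x y)) r)
            S⇒R : ⟦ S ⟧ ⇒ R
            S⇒R {x} {y} s = subst (λ A → A) (decode x y)
                              (Equivalence.to (S⇔ _) s)
        in none (S , simulation-resp R⇒S S⇒R sim , R⇒S vRw)

  _≡ᵈ?_ : Binary.Decidable _≡ᵈ_
  v ≡ᵈ? w = v ≤ᵈ? w ×-dec w ≤ᵈ? v

  Min : V → Pred V (suc 0ℓ)
  Min v v′ = v′ ∈ v • × (∀ {u} → u ∈ v • → u ≤ᵈ v′ → v′ ≤ᵈ u)

  Max : V → Pred V (suc 0ℓ)
  Max v v′ = v′ ∈ v • × (∀ {u} → u ∈ v • → v′ ≤ᵈ u → u ≤ᵈ v′)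

  Min? : ∀ v → Decidable (Min v)
  Min? v v′ = v ⟶? v′ ×-dec
    map′ (λ h {u} → h u) (λ h u → h {u})
         (all? λ u → v ⟶? u →-dec (u ≤ᵈ? v′ →-dec v′ ≤ᵈ? u))

  -- The cardinality of the set of ≡ᵈ-classes met by U.
  ∣[_]∣ : {U : Pred V ℓ} → Decidable U → ℕ
  ∣[ U? ]∣ = length (deduplicate _≡ᵈ?_ (filter U? vertices))

  Class : V → Pred V (suc 0ℓ)
  Class c v = v ≡ᵈ c

  Class? : ∀ c → Decidable (Class c)
  Class? c v = v ≡ᵈ? c

record Structure : Set₂ where
  infix 4 _⟶_
  field
    Vertex : Setoid 0ℓ (suc 0ℓ)
  open Setoid Vertex public using (Carrier; _≈_)
  field
    _⟶_    : Rel Carrier (suc 0ℓ)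
    Ω      : Carrier → ℕ
    𝒫      : Carrier → Player
    ⟶-resp : ∀ {c c′ d d′} → c ≈ c′ → d ≈ d′ → c ⟶ d → c′ ⟶ d′
    Ω-cong : ∀ {c c′} → c ≈ c′ → Ω c ≡ Ω c′
    𝒫-cong : ∀ {c c′} → c ≈ c′ → 𝒫 c ≡ 𝒫 c′

-- A class is represented by any of its members, with ≡ᵈ as equality of
-- representatives.
module Quotient (G : ParityGame) where
  open Game G
  open DirectSimulation G

  infix 4 _⟶q_

  AllOdd : V → Set₁
  AllOdd c = Class c ⊆ V⟨ □ ⟩

  AllOdd? : ∀ c → Dec (AllOdd c)
  AllOdd? c = ⊆? (Class? c) V⟨ □ ⟩?

  -- c is a member of its own class, so the default value of min is harmless.
  Ωq : V → ℕ
  Ωq c = min (Ω c) (map Ω (filter (Class? c) vertices))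

  OddOwned : V → Set₁
  OddOwned c = AllOdd c × Class c ⊆ (λ u → ∣[ Min? u ]∣ > 1)

  OddOwned? : ∀ c → Dec (OddOwned c)
  OddOwned? c = AllOdd? c ×-dec ⊆? (Class? c) (λ u → 1 ℕ.<? ∣[ Min? u ]∣)

  𝒫q : V → Player
  𝒫q c = if does (OddOwned? c) then □ else ◇

  _⟶q_ : Rel V (suc 0ℓ)
  c ⟶q c′ =
      (AllOdd c → ∀ {v} → v ∈ Class c → Min v ≬ Class c′)
    × (¬ AllOdd c → ∀ {v} → v ∈ Class c → v ∈ V⟨ ◇ ⟩ → Max v ≬ Class c′)

  private
    Class-resp : ∀ {c c′} → c ≡ᵈ c′ → Class c ⊆ Class c′
    Class-resp c≡c′ v≡c = ≡ᵈ-trans v≡c c≡c′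

    OddOwned-resp : ∀ {c c′} → c ≡ᵈ c′ → OddOwned c → OddOwned c′
    OddOwned-resp c≡c′ (odd , big) =
        (λ v∈c′ → odd (Class-resp (≡ᵈ-sym c≡c′) v∈c′))
      , (λ v∈c′ → big (Class-resp (≡ᵈ-sym c≡c′) v∈c′))

    Ωq-cong : ∀ {c c′} → c ≡ᵈ c′ → Ωq c ≡ Ωq c′
    Ωq-cong {c} {c′} c≡c′@((_ , sim , r) , _) = cong₂ min (proj₁ (sim r))
      (cong (map Ω) (filter-≐ (Class? c) (Class? c′)
        (Class-resp c≡c′ , Class-resp (≡ᵈ-sym c≡c′)) vertices))

    𝒫q-cong : ∀ {c c′} → c ≡ᵈ c′ → 𝒫q c ≡ 𝒫q c′
    𝒫q-cong {c} {c′} c≡c′ = cong (if_then □ else ◇)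
      (does-⇔ (mk⇔ (OddOwned-resp c≡c′) (OddOwned-resp (≡ᵈ-sym c≡c′)))
              (OddOwned? c) (OddOwned? c′))

    ⟶q-resp : ∀ {c c′ d d′} → c ≡ᵈ c′ → d ≡ᵈ d′ → c ⟶q d → c′ ⟶q d′
    ⟶q-resp c≡c′ d≡d′ (odd , other) =
        (λ allOdd v∈c′ →
          let v′ , min , v′∈d = odd (allOdd ∘ Class-resp c≡c′)
                                    (Class-resp (≡ᵈ-sym c≡c′) v∈c′)
          in v′ , min , Class-resp d≡d′ v′∈d)
      , (λ ¬allOdd v∈c′ ◇v →
          let v′ , max , v′∈d =
                other (λ allOdd → ¬allOdd (allOdd ∘ Class-resp (≡ᵈ-sym c≡c′)))
                      (Class-resp (≡ᵈ-sym c≡c′) v∈c′) ◇v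
          in v′ , max , Class-resp d≡d′ v′∈d)

  quotient : Structure
  quotient = record
    { Vertex = ≡ᵈ-setoid
    ; _⟶_    = _⟶q_
    ; Ω      = Ωq
    ; 𝒫      = 𝒫q
    ; ⟶-resp = ⟶q-resp
    ; Ω-cong = Ωq-cong
    ; 𝒫-cong = 𝒫q-cong
    }

infix 8 _/≡ᵈ

_/≡ᵈ : ParityGame → Structure
G /≡ᵈ = Quotient.quotient G

infix 4 _≅_ _∼[_]_ _≡ᵈᴳ_

record _≅_ (A B : Structure) : Set₁ where
  private
    module A = Structure A
    module B = Structure B
  field
    bijection : Bijection A.Vertex B.Vertex
  open Bijection bijection public using (to)
  field
    Ω-preserved : ∀ c → B.Ω (to c) ≡ A.Ω c
    𝒫-preserved : ∀ c → B.𝒫 (to c) ≡ A.𝒫 c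
    ⟶-preserved : ∀ c d → (c A.⟶ d) ⇔ (to c B.⟶ to d)

_∼[_]_ : ParityGame → (∀ G → Rel (ParityGame.V G) ℓ) → ParityGame → Set ℓ
G ∼[ E ] H =
    (∀ v₁ → ∃ λ v₂ → inj₁ v₁ ∼ inj₂ v₂)
  × (∀ v₂ → ∃ λ v₁ → inj₁ v₁ ∼ inj₂ v₂)
  where
  infix 4 _∼_
  _∼_ = E (G ⊎ᴳ H)

_≡ᵈᴳ_ : ParityGame → ParityGame → Set₁
G ≡ᵈᴳ H = G ∼[ DirectSimulation._≡ᵈ_ ] H

{-# OPTIONS --safe #-}
module Submission where

-- Let Ext v consist of the ≤ᵈ-maximal successors of v if v is even and of the
-- minimal ones if v is odd. The set of classes met by Ext v, and whether v is
-- an odd vertex with several minimal successor classes, depend only on the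
-- class of v, even when the class contains vertices of both players; together
-- with Ω v they determine the quotient at [v]. Hence an equivalence of games
-- induces an isomorphism. Conversely, given an isomorphism f, the relation
-- ≤ᵈ ⨾ {(v , w) | w ∈ f [v]} ⨾ ≤ᵈ is a direct simulation on the disjoint union.

open import Defs
open import Data.Bool.Base using (if_then_else_)
open import Data.Empty using (⊥-elim)
open import Data.List.Base using ([]; _∷_; length; deduplicate)
open import Data.List.Extrema.Nat using (argmin-all)
open import Data.List.Membership.Propositional as List using ()
import Data.List.Membership.Setoid as SetoidMembership
open import Data.List.Membership.Propositional.Properties
  using (∈-map⁺; ∈-map⁻; ∈-filter⁺; ∈-filter⁻; ∈-allFin; ∈-deduplicate⁻)
import Data.List.Membership.Setoid.Properties as SetoidMembershipₚ
open import Data.List.Relation.Unary.All as All using (_∷_)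
open import Data.List.Relation.Unary.AllPairs using (_∷_)
open import Data.List.Relation.Unary.Any as Any using (here; there)
open import Data.List.Relation.Unary.Unique.DecSetoid.Properties using (deduplicate-!)
open import Data.Nat.Base using (_>_; s≤s; z≤n)
open import Data.Product.Base using (∃; _×_; _,_; proj₁; proj₂)
open import Data.Sum.Base using (_⊎_; inj₁; inj₂)
open import Data.Sum.Relation.Binary.Pointwise using (inj₁; inj₂)
open import Function.Base using (flip; id; _∘_)
open import Function.Bundles using (_⇔_; mk⇔; Bijection; Equivalence)
open import Level using (Level; 0ℓ; suc; _⊔_)
open import Relation.Binary.Bundles using (DecSetoid)
open import Relation.Binary.Core using (Rel; _⇒_)
open import Relation.Binary.Definitions as Binary using (Reflexive; Transitive)
open import Relation.Binary.PropositionalEquality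
  using (_≡_; _≢_; refl; sym; trans; cong; subst)
open import Relation.Nullary.Decidable
  using (Dec; yes; no; does; does-⇔; _×-dec_; decidable-stable)
open import Relation.Nullary.Negation using (¬_; contradiction)
open import Relation.Unary using (Pred; Decidable; _⊆_; _≬_)

private
  variable
    a p ℓ ℓ′ : Level

-- Players, maximal elements of a preorder, and counting classes in a list.

◇≢□ : ◇ ≢ □
◇≢□ ()

≢◇⇒≡□ : ∀ {i} → i ≢ ◇ → i ≡ □
≢◇⇒≡□ {◇} ◇≢◇ = ⊥-elim (◇≢◇ refl)
≢◇⇒≡□ {□} _   = refl

-- The candidate found in the tail gives way to the head exactly when the head satisfies `P` and
-- lies above it; whatever is above the new candidate is also above the old one. Reversing the order
-- yields minima.
maximal-above : {A : Set a} {_≤_ : Rel A ℓ} {P : Pred A p} →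
  Reflexive _≤_ → Transitive _≤_ → Binary.Decidable _≤_ → Decidable P →
  ∀ xs {x} → P x →
  ∃ λ m → P m × x ≤ m × (∀ {u} → u List.∈ xs → P u → m ≤ u → u ≤ m)
maximal-above ≤-refl ≤-trans _≤?_ P? [] {x} Px = x , Px , ≤-refl , λ ()
maximal-above ≤-refl ≤-trans _≤?_ P? (y ∷ ys) Px
  with m , Pm , x≤m , max ← maximal-above ≤-refl ≤-trans _≤?_ P? ys Px
  with P? y ×-dec m ≤? y
... | yes (Py , m≤y) = y , Py , ≤-trans x≤m m≤y , λ
  { (here refl) _  _   → ≤-refl
  ; (there u∈)  Pu y≤u → ≤-trans (max u∈ Pu (≤-trans m≤y y≤u)) m≤y
  }
... | no ¬y = m , Pm , x≤m , λ
  { (here refl) Pu m≤u → contradiction (Pu , m≤u) ¬y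
  ; (there u∈)  Pu m≤u → max u∈ Pu m≤u
  }

module _ (DS : DecSetoid a ℓ) where
  open DecSetoid DS using (_≈_; _≟_; setoid)
  private module Eq = DecSetoid DS

  distinct⇒length-deduplicate>1 : ∀ {xs x y} →
    x List.∈ xs → y List.∈ xs → ¬ x ≈ y → length (deduplicate _≟_ xs) > 1
  distinct⇒length-deduplicate>1 {xs} {x} {y} x∈ y∈ x≉y =
    two (dedup x∈) (dedup y∈)
    where
    open SetoidMembership setoid using () renaming (_∈_ to _∈≈_)
    dedup : ∀ {z} → z List.∈ xs → z ∈≈ deduplicate _≟_ xs
    dedup z∈ = SetoidMembershipₚ.∈-deduplicate⁺ setoid _≟_
      (λ z≈y x≈y → Eq.trans x≈y (Eq.sym z≈y)) (Any.map Eq.reflexive z∈)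
    two : ∀ {ys} → x ∈≈ ys → y ∈≈ ys → length ys > 1
    two {_ ∷ []}    (here x≈) (here y≈) = contradiction (Eq.trans x≈ (Eq.sym y≈)) x≉y
    two {_ ∷ _ ∷ _} _         _         = s≤s (s≤s z≤n)

  length-deduplicate>1⇒distinct : ∀ {xs} → length (deduplicate _≟_ xs) > 1 →
    ∃ λ x → ∃ λ y → x List.∈ xs × y List.∈ xs × ¬ x ≈ y
  length-deduplicate>1⇒distinct {xs} len
    with deduplicate _≟_ xs | ∈-deduplicate⁻ _≟_ xs | deduplicate-! DS xs
  length-deduplicate>1⇒distinct (s≤s ()) | _ ∷ []    | _    | _
  length-deduplicate>1⇒distinct _        | x ∷ y ∷ _ | ⊆xs | (x≉y ∷ _) ∷ _ =
    x , y , ⊆xs (here refl) , ⊆xs (there (here refl)) , x≉y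

-- Direct simulation within one game.

module Properties (G : ParityGame) where
  open Game G public
  open DirectSimulation G public
  open Quotient G public

  ∈-vertices : ∀ v → v List.∈ vertices
  ∈-vertices v = subst (List._∈ vertices) (vertex-index v)
                   (∈-map⁺ vertex (∈-allFin (index v)))

  ≡ᵈ-decSetoid : DecSetoid 0ℓ (suc 0ℓ)
  ≡ᵈ-decSetoid = record
    { isDecEquivalence = record
      { isEquivalence = record { refl = ≡ᵈ-refl ; sym = ≡ᵈ-sym ; trans = ≡ᵈ-trans }
      ; _≟_ = _≡ᵈ?_
      }
    }

  -- `IsDirectSimulation` is confined to relations in `Set`, while `_≤ᵈ_` and composites with it
  -- live higher; hence a level-polymorphic copy.
  IsSim : Rel V ℓ → Set ℓ
  IsSim R = ∀ {v w} → R v w →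
      Ω v ≡ Ω w
    × (𝒫 v ≡ ◇ → ∀ {v′} → v ⟶ v′ → w ⟶⟨ ◇ ⟩ R v′)
    × (𝒫 v ≡ □ → w ⟶⟨ ◇ ⟩ (v •) [ R ])

  isDirectSimulation⇒≤ᵈ : {R : Rel V 0ℓ} → IsDirectSimulation R → R ⇒ _≤ᵈ_
  isDirectSimulation⇒≤ᵈ {R} sim r = R , sim , r

  -- `_≤ᵈ_` is the union of all direct simulations: the one witnessing a pair meets the clauses for
  -- that pair, and forcing is monotone.
  ≤ᵈ-isSim : IsSim _≤ᵈ_
  ≤ᵈ-isSim (R , sim , r) with sim r
  ... | Ω≡ , even , odd =
      Ω≡
    , (λ ◇v e → ⟶⟨⟩-mono (isDirectSimulation⇒≤ᵈ sim) (even ◇v e))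
    , (λ □v → ⟶⟨⟩-mono (λ (u , e , r) → u , e , isDirectSimulation⇒≤ᵈ sim r) (odd □v))

  -- Direct simulations are Set-valued; decidability brings R down to Set.
  isSim⇒≤ᵈ : {R : Rel V ℓ} → Binary.Decidable R → IsSim R → R ⇒ _≤ᵈ_
  isSim⇒≤ᵈ {R = R} R? sim {v} {w} r = S , simS , lower r
    where
    S : Rel V 0ℓ
    -- `does (yes r)` reduces to `true`, so this is the Boolean test for `R` read as a small
    -- proposition.
    S x y = does (R? x y) ≡ does (yes r)
    lower : R ⇒ S
    lower {x} {y} r with R? x y
    ... | yes _  = refl
    ... | no ¬r = contradiction r ¬r
    raise : S ⇒ R
    raise {x} {y} s with R? x y
    ... | yes r = r
    raise {x} {y} () | no _
    simS : IsDirectSimulation S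
    simS s with sim (raise s)
    ... | Ω≡ , even , odd =
        Ω≡
      , (λ ◇v e → ⟶⟨⟩-mono lower (even ◇v e))
      , (λ □v → ⟶⟨⟩-mono (λ (u , e , r) → u , e , lower r) (odd □v))

  forced-by-◇ : ∀ {w} {T : Pred V ℓ} → 𝒫 w ≡ ◇ → w ⟶⟨ ◇ ⟩ T → w • ≬ T
  forced-by-◇ ◇w (inj₁ (_ , h))   = h
  forced-by-◇ ◇w (inj₂ (¬◇w , _)) = contradiction ◇w ¬◇w

  forced-by-□ : ∀ {w} {T : Pred V ℓ} → 𝒫 w ≡ □ → w ⟶⟨ ◇ ⟩ T → w • ⊆ T
  forced-by-□ □w (inj₁ (◇w , _)) = contradiction (trans (sym ◇w) □w) ◇≢□
  forced-by-□ □w (inj₂ (_ , h))  = h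

  -- If `y` is even, its chosen successor is answered from `z`; if `y` is odd, the successor used by
  -- the odd clause lies in `T` like all the others. This is the composition step for simulations.
  force-≤ᵈ : ∀ {y z} {T : Pred V ℓ} →
             y ≤ᵈ z → y ⟶⟨ ◇ ⟩ T → z ⟶⟨ ◇ ⟩ T [ _≤ᵈ_ ]
  force-≤ᵈ y≤z (inj₁ (◇y , y′ , e , t)) =
    ⟶⟨⟩-mono (λ s → y′ , t , s) (proj₁ (proj₂ (≤ᵈ-isSim y≤z)) ◇y e)
  force-≤ᵈ y≤z (inj₂ (¬◇y , h)) =
    ⟶⟨⟩-mono (λ (y′ , e , s) → y′ , h e , s)
             (proj₂ (proj₂ (≤ᵈ-isSim y≤z)) (≢◇⇒≡□ ¬◇y))

  module _ {v w} (v≤w : v ≤ᵈ w) where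

    ≤ᵈ⇒Ω≡ : Ω v ≡ Ω w
    ≤ᵈ⇒Ω≡ = proj₁ (≤ᵈ-isSim v≤w)

    ≤ᵈ-◇◇ : 𝒫 v ≡ ◇ → 𝒫 w ≡ ◇ → ∀ {v′} → v ⟶ v′ → ∃ λ w′ → w ⟶ w′ × v′ ≤ᵈ w′
    ≤ᵈ-◇◇ ◇v ◇w e = forced-by-◇ ◇w (proj₁ (proj₂ (≤ᵈ-isSim v≤w)) ◇v e)

    ≤ᵈ-◇□ : 𝒫 v ≡ ◇ → 𝒫 w ≡ □ → ∀ {v′ w′} → v ⟶ v′ → w ⟶ w′ → v′ ≤ᵈ w′
    ≤ᵈ-◇□ ◇v □w e = forced-by-□ □w (proj₁ (proj₂ (≤ᵈ-isSim v≤w)) ◇v e)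

    ≤ᵈ-□◇ : 𝒫 v ≡ □ → 𝒫 w ≡ ◇ → ∃ λ w′ → w ⟶ w′ × ∃ λ v′ → v ⟶ v′ × v′ ≤ᵈ w′
    ≤ᵈ-□◇ □v ◇w = forced-by-◇ ◇w (proj₂ (proj₂ (≤ᵈ-isSim v≤w)) □v)

    ≤ᵈ-□□ : 𝒫 v ≡ □ → 𝒫 w ≡ □ → ∀ {w′} → w ⟶ w′ → ∃ λ v′ → v ⟶ v′ × v′ ≤ᵈ w′
    ≤ᵈ-□□ □v □w = forced-by-□ □w (proj₂ (proj₂ (≤ᵈ-isSim v≤w)) □v)

  -- Extremal successors and their invariance under equivalence.

  Max-above : ∀ {v v′} → v ⟶ v′ → ∃ λ m → Max v m × v′ ≤ᵈ m
  Max-above {v} e =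
    let m , v⟶m , v′≤m , max =
          maximal-above ≤ᵈ-refl ≤ᵈ-trans _≤ᵈ?_ (v ⟶?_) vertices e
    in m , (v⟶m , max (∈-vertices _)) , v′≤m

  Min-below : ∀ {v v′} → v ⟶ v′ → ∃ λ m → Min v m × m ≤ᵈ v′
  Min-below {v} e =
    let m , v⟶m , m≤v′ , min =
          maximal-above {_≤_ = flip _≤ᵈ_} ≤ᵈ-refl (flip ≤ᵈ-trans) (flip _≤ᵈ?_)
                        (v ⟶?_) vertices e
    in m , (v⟶m , min (∈-vertices _)) , m≤v′

  Ext : Player → V → Pred V (suc 0ℓ)
  Ext ◇ = Max
  Ext □ = Min

  -- With equal owners, `x` is matched in `w` and the match is answered back in `v`; extremality of
  -- `x` closes the loop. With different owners, `≤ᵈ-◇□` puts every successor of the even vertex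
  -- below every successor of the odd one, and `≤ᵈ-□◇` gives one pair in reverse. That pair is
  -- greatest on the even side and least on the odd side, so both vertices have a single extremal
  -- class, the same one.
  Ext-resp : ∀ i j {v w x} → 𝒫 v ≡ i → 𝒫 w ≡ j → v ≡ᵈ w →
             Ext i v x → Ext j w ≬ Class x
  Ext-resp ◇ ◇ ◇v ◇w (v≤w , w≤v) (v⟶x , max)
    with y , w⟶y , x≤y ← ≤ᵈ-◇◇ v≤w ◇v ◇w v⟶x
    = y , (w⟶y , λ w⟶u y≤u → ≤ᵈ-trans (≤x w⟶u (≤ᵈ-trans x≤y y≤u)) x≤y)
    , ≤x w⟶y x≤y , x≤y
    where
    -- Used twice: at `u = y` it makes `y` equivalent to `x`, at other `u` it gives maximality of
    -- `y`.
    ≤x : ∀ {u} → _ ⟶ u → _ ≤ᵈ u → u ≤ᵈ _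
    ≤x w⟶u x≤u =
      let z , v⟶z , u≤z = ≤ᵈ-◇◇ w≤v ◇w ◇v w⟶u
      in ≤ᵈ-trans u≤z (max v⟶z (≤ᵈ-trans x≤u u≤z))
  Ext-resp □ □ □v □w (v≤w , w≤v) (v⟶x , min)
    with y , w⟶y , y≤x ← ≤ᵈ-□□ w≤v □w □v v⟶x
    = y , (w⟶y , λ w⟶u u≤y → ≤ᵈ-trans y≤x (x≤ w⟶u (≤ᵈ-trans u≤y y≤x)))
    , y≤x , x≤ w⟶y y≤x
    where
    x≤ : ∀ {u} → _ ⟶ u → u ≤ᵈ _ → _ ≤ᵈ u
    x≤ w⟶u u≤x =
      let z , v⟶z , z≤u = ≤ᵈ-□□ v≤w □v □w w⟶u
      in ≤ᵈ-trans (min v⟶z (≤ᵈ-trans z≤u u≤x)) z≤u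
  Ext-resp ◇ □ ◇v □w (v≤w , w≤v) (v⟶x , max)
    with v₀ , v⟶v₀ , w₀ , w⟶w₀ , w₀≤v₀ ← ≤ᵈ-□◇ w≤v □w ◇v
    = w₀ , (w⟶w₀ , λ w⟶u _ → ≤ᵈ-trans w₀≤v₀ (≤ᵈ-◇□ v≤w ◇v □w v⟶v₀ w⟶u))
    , ≤ᵈ-trans w₀≤v₀ (max v⟶v₀ (≤ᵈ-trans x≤w₀ w₀≤v₀)) , x≤w₀
    where x≤w₀ = ≤ᵈ-◇□ v≤w ◇v □w v⟶x w⟶w₀
  Ext-resp □ ◇ □v ◇w (v≤w , w≤v) (v⟶x , min)
    with w₀ , w⟶w₀ , v₀ , v⟶v₀ , v₀≤w₀ ← ≤ᵈ-□◇ v≤w □v ◇w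
    = w₀ , (w⟶w₀ , λ w⟶u _ → ≤ᵈ-trans (≤ᵈ-◇□ w≤v ◇w □v w⟶u v⟶v₀) v₀≤w₀)
    , w₀≤x , ≤ᵈ-trans (min v⟶v₀ (≤ᵈ-trans v₀≤w₀ w₀≤x)) v₀≤w₀
    where w₀≤x = ≤ᵈ-◇□ w≤v ◇w □v w⟶w₀ v⟶x

  -- The quotient read off a single representative.

  infix 4 _↠_

  -- Unlike `_⟶q_`, this consults only `v` and its own owner, with no case distinction on `AllOdd`;
  -- `⟶q⇒↠` and `↠⇒⟶q` show that the two agree.
  _↠_ : Rel V (suc 0ℓ)
  v ↠ d = Ext (𝒫 v) v ≬ Class d

  ↠-resp : ∀ {v w d} → v ≡ᵈ w → v ↠ d → w ↠ d
  ↠-resp {v} {w} v≡w (x , ext , x≡d) =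
    let y , ext′ , y≡x = Ext-resp (𝒫 v) (𝒫 w) refl refl v≡w ext
    in y , ext′ , ≡ᵈ-trans y≡x x≡d

  ↠-respʳ : ∀ v {d d′} → d ≡ᵈ d′ → v ↠ d → v ↠ d′
  ↠-respʳ _ d≡d′ (x , ext , x≡d) = x , ext , ≡ᵈ-trans x≡d d≡d′

  ↠⇒Ext : ∀ {i v d} → 𝒫 v ≡ i → v ↠ d → Ext i v ≬ Class d
  ↠⇒Ext refl v↠d = v↠d

  Ext⇒↠ : ∀ {i v d} → 𝒫 v ≡ i → Ext i v ≬ Class d → v ↠ d
  Ext⇒↠ refl ext = ext

  -- Finiteness makes the search for an even member decidable, so a refuted universal statement
  -- yields a witness constructively.
  ¬AllOdd⇒even : ∀ {c} → ¬ AllOdd c → ∃ λ v → v ≡ᵈ c × 𝒫 v ≡ ◇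
  ¬AllOdd⇒even {c} ¬allOdd =
    decidable-stable (any? λ v → Class? c v ×-dec V⟨ ◇ ⟩? v) λ ¬even →
      ¬allOdd λ v≡c → ≢◇⇒≡□ λ ◇v → ¬even (_ , v≡c , ◇v)

  -- In a class that is not all odd, a quotient edge constrains only the even members. One exists,
  -- and `↠-resp` carries its edge to `c`, whoever owns `c`.
  ⟶q⇒↠ : ∀ {c d} → c ⟶q d → c ↠ d
  ⟶q⇒↠ {c} {d} (odd , other) = by (AllOdd? c)
    where
    by : Dec (AllOdd c) → c ↠ d
    by (yes allOdd) = Ext⇒↠ (allOdd ≡ᵈ-refl) (odd allOdd ≡ᵈ-refl)
    by (no ¬allOdd) =
      let v , v≡c , ◇v = ¬AllOdd⇒even ¬allOdd
      in ↠-resp v≡c (Ext⇒↠ ◇v (other ¬allOdd v≡c ◇v))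

  ↠⇒⟶q : ∀ {c d} → c ↠ d → c ⟶q d
  ↠⇒⟶q c↠d =
      (λ allOdd v≡c → ↠⇒Ext (allOdd v≡c) (↠-resp (≡ᵈ-sym v≡c) c↠d))
    , (λ _ v≡c ◇v → ↠⇒Ext ◇v (↠-resp (≡ᵈ-sym v≡c) c↠d))

  Multi : Pred V (suc 0ℓ)
  Multi v = 𝒫 v ≡ □ × ∃ λ x → ∃ λ y → Min v x × Min v y × ¬ x ≡ᵈ y

  -- `Ext-resp` carries both witnesses to an odd `w`. An even `w` is impossible: `v₀` lies below
  -- `w₀`, which lies below all successors of `v`, so `v` has one minimal class.
  Multi-resp : ∀ {v w} → v ≡ᵈ w → Multi v → Multi w
  Multi-resp {v} {w} v≡w@(v≤w , w≤v) (□v , x , y , minx , miny , x≢y)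
    with 𝒫 w in eq
  ... | □ =
    let x′ , minx′ , x′≡x = Ext-resp □ □ □v eq v≡w minx
        y′ , miny′ , y′≡y = Ext-resp □ □ □v eq v≡w miny
    in refl , x′ , y′ , minx′ , miny′ , λ x′≡y′ →
         x≢y (≡ᵈ-trans (≡ᵈ-sym x′≡x) (≡ᵈ-trans x′≡y′ y′≡y))
  ... | ◇ with w₀ , w⟶w₀ , v₀ , v⟶v₀ , v₀≤w₀ ← ≤ᵈ-□◇ v≤w □v eq =
    contradiction (below minx (proj₁ miny) , below miny (proj₁ minx)) x≢y
    where
    below : ∀ {x y} → Min v x → v ⟶ y → x ≤ᵈ y
    below (v⟶x , min) v⟶y = ≤ᵈ-trans
      (min v⟶v₀ (≤ᵈ-trans v₀≤w₀ (≤ᵈ-◇□ w≤v eq □v w⟶w₀ v⟶x)))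
      (≤ᵈ-trans v₀≤w₀ (≤ᵈ-◇□ w≤v eq □v w⟶w₀ v⟶y))

  OddOwned⇒Multi : ∀ {c} → OddOwned c → Multi c
  OddOwned⇒Multi {c} (allOdd , big) =
    let x , y , x∈ , y∈ , x≢y =
          length-deduplicate>1⇒distinct ≡ᵈ-decSetoid (big (≡ᵈ-refl {c}))
    in allOdd ≡ᵈ-refl , x , y
     , proj₂ (∈-filter⁻ (Min? c) {xs = vertices} x∈)
     , proj₂ (∈-filter⁻ (Min? c) {xs = vertices} y∈) , x≢y

  -- `Multi-resp` spreads the property of the representative `c` over its whole class.
  Multi⇒OddOwned : ∀ {c} → Multi c → OddOwned c
  Multi⇒OddOwned multi =
      (λ v≡c → proj₁ (Multi-resp (≡ᵈ-sym v≡c) multi))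
    , (λ {v} v≡c →
        let _ , x , y , minx , miny , x≢y = Multi-resp (≡ᵈ-sym v≡c) multi
        in distinct⇒length-deduplicate>1 ≡ᵈ-decSetoid
             (∈-filter⁺ (Min? v) (∈-vertices x) minx)
             (∈-filter⁺ (Min? v) (∈-vertices y) miny) x≢y)

  ¬Multi⇒Min≡ᵈ : ∀ {v x y} → 𝒫 v ≡ □ → ¬ Multi v → Min v x → Min v y → x ≡ᵈ y
  ¬Multi⇒Min≡ᵈ {x = x} {y} □v ¬multi minx miny =
    decidable-stable (x ≡ᵈ? y) λ x≢y → ¬multi (□v , x , y , minx , miny , x≢y)

  -- Equivalent vertices share their priority, so all entries of the list equal `Ω c`, and so does
  -- the default value of `min`.
  Ωq≡Ω : ∀ c → Ωq c ≡ Ω c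
  Ωq≡Ω c = argmin-all id {P = _≡ Ω c} refl (All.tabulate λ n∈ →
    let v , v∈ , n≡Ωv = ∈-map⁻ Ω n∈
        v≤c , _ = proj₂ (∈-filter⁻ (Class? c) {xs = vertices} v∈)
    in trans n≡Ωv (≤ᵈ⇒Ω≡ v≤c))

-- Recovers `OddOwned` across an isomorphism from the mere equality of the owners `𝒫q`.
owner-reflects : {A : Set a} {B : Set p} (a? : Dec A) (b? : Dec B) →
  (if does a? then □ else ◇) ≡ (if does b? then □ else ◇) → A → B
owner-reflects (yes _) (yes b) _  _ = b
owner-reflects (yes _) (no _)  ()
owner-reflects (no ¬a) _       _  a = contradiction a ¬a

-- Embeddings of games, such as the injections into a disjoint union.

record Embedding (G H : ParityGame) : Set where
  private
    module G = Properties G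
    module H = Properties H
  field
    embed  : G.V → H.V
    Ω-pres : ∀ v → H.Ω (embed v) ≡ G.Ω v
    𝒫-pres : ∀ v → H.𝒫 (embed v) ≡ G.𝒫 v
    ⟶-pres : ∀ {v w} → v G.⟶ w → embed v H.⟶ embed w
    ⟶-reflects : ∀ {v w} → embed v H.⟶ embed w → v G.⟶ w
    -- The image is closed under successors, so forcing, simulation and extremality at an image
    -- vertex never look outside it.
    ⟶-lift : ∀ {v x} → embed v H.⟶ x → ∃ λ w → x ≡ embed w

  force-pres : ∀ {i v} {T : Pred G.V ℓ} {U : Pred H.V ℓ′} →
               (∀ {w} → T w → U (embed w)) → v G.⟶⟨ i ⟩ T → embed v H.⟶⟨ i ⟩ U
  force-pres f (inj₁ (pv , w , e , t)) =
    inj₁ (trans (𝒫-pres _) pv , embed w , ⟶-pres e , f t)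
  force-pres {v = v} {U = U} f (inj₂ (pv , h)) = inj₂ (pv ∘ trans (sym (𝒫-pres _)) , step)
    where
    step : ∀ {x} → embed v H.⟶ x → U x
    step e with w , refl ← ⟶-lift e = f (h (⟶-reflects e))

  force-reflects : ∀ {i v} {U : Pred H.V ℓ} {T : Pred G.V ℓ′} →
               (∀ {w} → U (embed w) → T w) → embed v H.⟶⟨ i ⟩ U → v G.⟶⟨ i ⟩ T
  force-reflects f (inj₁ (pv , x , e , u)) with w , refl ← ⟶-lift e =
    inj₁ (trans (sym (𝒫-pres _)) pv , w , ⟶-reflects e , f u)
  force-reflects f (inj₂ (pv , h)) =
    inj₂ (pv ∘ trans (𝒫-pres _) , λ e → f (h (⟶-pres e)))

  -- The direct image of a simulation is a simulation because `⟶-lift` pulls every challenge back to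
  -- `G`; `≤ᵈ-reflects` takes the preimage instead.
  ≤ᵈ-pres : ∀ {v w} → v G.≤ᵈ w → embed v H.≤ᵈ embed w
  ≤ᵈ-pres {v} {w} (R , sim , r) = S , simS , v , w , refl , refl , r
    where
    S : Rel H.V 0ℓ
    S x y = ∃ λ v → ∃ λ w → x ≡ embed v × y ≡ embed w × R v w
    simS : H.IsDirectSimulation S
    simS (v , w , refl , refl , r) with sim r
    ... | Ω≡ , even , odd =
        trans (Ω-pres v) (trans Ω≡ (sym (Ω-pres w)))
      , step
      , λ □v → force-pres (λ (u , e , r) → embed u , ⟶-pres e , u , _ , refl , refl , r)
                          (odd (trans (sym (𝒫-pres v)) □v))
      where
      step : H.𝒫 (embed v) ≡ ◇ → ∀ {x} → embed v H.⟶ x → embed w H.⟶⟨ ◇ ⟩ S x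
      step ◇v e with v′ , refl ← ⟶-lift e =
        force-pres (λ r → v′ , _ , refl , refl , r)
                   (even (trans (sym (𝒫-pres v)) ◇v) (⟶-reflects e))

  ≤ᵈ-reflects : ∀ {v w} → embed v H.≤ᵈ embed w → v G.≤ᵈ w
  ≤ᵈ-reflects {v} {w} (R , sim , r) = S , simS , r
    where
    S : Rel G.V 0ℓ
    S v w = R (embed v) (embed w)
    simS : G.IsDirectSimulation S
    simS {v} {w} r with sim r
    ... | Ω≡ , even , odd =
        trans (sym (Ω-pres v)) (trans Ω≡ (Ω-pres w))
      , (λ ◇v e → force-reflects (λ r → r) (even (trans (𝒫-pres v) ◇v) (⟶-pres e)))
      , λ □v → force-reflects back (odd (trans (𝒫-pres v) □v))
      where
      back : ∀ {y} → (embed v H.• H.[ R ]) (embed y) → (v G.• G.[ S ]) y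
      back (x , e , r) with u , refl ← ⟶-lift e = u , ⟶-reflects e , r

  ≡ᵈ-pres : ∀ {v w} → v G.≡ᵈ w → embed v H.≡ᵈ embed w
  ≡ᵈ-pres (v≤w , w≤v) = ≤ᵈ-pres v≤w , ≤ᵈ-pres w≤v

  ≡ᵈ-reflects : ∀ {v w} → embed v H.≡ᵈ embed w → v G.≡ᵈ w
  ≡ᵈ-reflects (v≤w , w≤v) = ≤ᵈ-reflects v≤w , ≤ᵈ-reflects w≤v

  Ext-pres : ∀ i {v x} → G.Ext i v x → H.Ext i (embed v) (embed x)
  Ext-pres ◇ {v} {x} (e , max) = ⟶-pres e , max′
    where
    max′ : ∀ {u} → embed v H.⟶ u → embed x H.≤ᵈ u → u H.≤ᵈ embed x
    max′ e x≤u with _ , refl ← ⟶-lift e = ≤ᵈ-pres (max (⟶-reflects e) (≤ᵈ-reflects x≤u))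
  Ext-pres □ {v} {x} (e , min) = ⟶-pres e , min′
    where
    min′ : ∀ {u} → embed v H.⟶ u → u H.≤ᵈ embed x → embed x H.≤ᵈ u
    min′ e u≤x with _ , refl ← ⟶-lift e = ≤ᵈ-pres (min (⟶-reflects e) (≤ᵈ-reflects u≤x))

  Ext-reflects : ∀ i {v x} → H.Ext i (embed v) (embed x) → G.Ext i v x
  Ext-reflects ◇ (e , max) =
    ⟶-reflects e , λ e′ x≤u → ≤ᵈ-reflects (max (⟶-pres e′) (≤ᵈ-pres x≤u))
  Ext-reflects □ (e , min) =
    ⟶-reflects e , λ e′ u≤x → ≤ᵈ-reflects (min (⟶-pres e′) (≤ᵈ-pres u≤x))

  Ext-lift : ∀ i {v x} → H.Ext i (embed v) x → ∃ λ w → x ≡ embed w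
  Ext-lift ◇ (e , _) = ⟶-lift e
  Ext-lift □ (e , _) = ⟶-lift e

  ↠-pres : ∀ {v d} → v G.↠ d → embed v H.↠ embed d
  ↠-pres {v} (x , ext , x≡d) =
    H.Ext⇒↠ (𝒫-pres v) (embed x , Ext-pres (G.𝒫 v) ext , ≡ᵈ-pres x≡d)

  ↠-reflects : ∀ {v d} → embed v H.↠ embed d → v G.↠ d
  ↠-reflects {v} v↠d with x , ext , x≡d ← H.↠⇒Ext (𝒫-pres v) v↠d
    with w , refl ← Ext-lift (G.𝒫 v) ext
    = w , Ext-reflects (G.𝒫 v) ext , ≡ᵈ-reflects x≡d

  Multi-pres : ∀ {v} → G.Multi v → H.Multi (embed v)
  Multi-pres (□v , x , y , minx , miny , x≢y) =
    trans (𝒫-pres _) □v , embed x , embed y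
    , Ext-pres □ minx , Ext-pres □ miny , x≢y ∘ ≡ᵈ-reflects

  Multi-reflects : ∀ {v} → H.Multi (embed v) → G.Multi v
  Multi-reflects (□v , x , y , minx , miny , x≢y)
    with _ , refl ← Ext-lift □ minx | _ , refl ← Ext-lift □ miny
    = trans (sym (𝒫-pres _)) □v , _ , _
    , Ext-reflects □ minx , Ext-reflects □ miny , x≢y ∘ ≡ᵈ-pres

module _ (G H : ParityGame) where

  inj₁-embedding : Embedding G (G ⊎ᴳ H)
  inj₁-embedding = record
    { embed  = inj₁
    ; Ω-pres = λ _ → refl
    ; 𝒫-pres = λ _ → refl
    ; ⟶-pres = inj₁
    ; ⟶-reflects = λ { (inj₁ e) → e }
    ; ⟶-lift = λ { (inj₁ e) → _ , refl }
    }

  inj₂-embedding : Embedding H (G ⊎ᴳ H)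
  inj₂-embedding = record
    { embed  = inj₂
    ; Ω-pres = λ _ → refl
    ; 𝒫-pres = λ _ → refl
    ; ⟶-pres = inj₂
    ; ⟶-reflects = λ { (inj₂ e) → e }
    ; ⟶-lift = λ { (inj₂ e) → _ , refl }
    }

-- From a correspondence of vertices to direct simulation.

module _ {G H K : ParityGame} (I : Embedding G K) (J : Embedding H K) where
  private
    module G = Properties G
    module H = Properties H
    module K = Properties K
    module I = Embedding I
    module J = Embedding J

  -- Only the case of an even v and an odd w needs the hypothesis on Multi: all
  -- of w's minimal successors must lie in a single class.
  correspondence⇒≤ᵈ : (E : G.V → H.V → Set ℓ) → (∀ v w → Dec (E v w)) →
    (∀ {v w} → E v w → G.Ω v ≡ H.Ω w) →
    (∀ {v w} → E v w → H.Multi w → G.Multi v) →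
    (∀ {v w x} → E v w → v G.↠ x → ∃ λ y → E x y × w H.↠ y) →
    (∀ {v w y} → E v w → w H.↠ y → ∃ λ x → E x y × v G.↠ x) →
    ∀ {v w} → E v w → I.embed v K.≤ᵈ J.embed w
  correspondence⇒≤ᵈ {ℓ = ℓ} E E? E⇒Ω E⇒Multi zig zag {v} {w} e =
    K.isSim⇒≤ᵈ S? simS (v , w , K.≤ᵈ-refl , e , K.≤ᵈ-refl)
    where
    S : Rel K.V (suc 0ℓ ⊔ ℓ)
    S x y = ∃ λ v → ∃ λ w → x K.≤ᵈ I.embed v × E v w × J.embed w K.≤ᵈ y

    S? : Binary.Decidable S
    S? x y = G.any? λ v → H.any? λ w →
      x K.≤ᵈ? I.embed v ×-dec E? v w ×-dec J.embed w K.≤ᵈ? y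

    E⇒S : ∀ {v v′ w w′} → v G.≤ᵈ v′ → E v′ w′ → w′ H.≤ᵈ w →
          S (I.embed v) (J.embed w)
    E⇒S v≤v′ e w′≤w = _ , _ , I.≤ᵈ-pres v≤v′ , e , J.≤ᵈ-pres w′≤w

    S-≤ᵈ : ∀ {x y z} → S x y → y K.≤ᵈ z → S x z
    S-≤ᵈ (v , w , x≤v , e , w≤y) y≤z = v , w , x≤v , e , K.≤ᵈ-trans w≤y y≤z

    ≤ᵈ-S : ∀ {x y z} → x K.≤ᵈ y → S y z → S x z
    ≤ᵈ-S x≤y (v , w , y≤v , e , w≤z) = v , w , K.≤ᵈ-trans x≤y y≤v , e , w≤z

    even-even : ∀ {v w v′} → E v w → G.𝒫 v ≡ ◇ → H.𝒫 w ≡ ◇ → v G.⟶ v′ →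
                ∃ λ w′ → w H.⟶ w′ × S (I.embed v′) (J.embed w′)
    even-even e ◇v ◇w v⟶v′ =
      -- Raising `v′` to a maximal `m` turns the edge into one seen by `_↠_`, so that `zig` applies;
      -- the gap is absorbed by the leading `_≤ᵈ_` of `S`.
      let m , max , v′≤m = G.Max-above v⟶v′
          y , e′ , w↠y = zig e (G.Ext⇒↠ ◇v (m , max , G.≡ᵈ-refl))
          w′ , (w⟶w′ , _) , _ , y≤w′ = H.↠⇒Ext ◇w w↠y
      in w′ , w⟶w′ , E⇒S v′≤m e′ y≤w′

    even-odd : ∀ {v w v′ w′} → E v w → G.𝒫 v ≡ ◇ → H.𝒫 w ≡ □ →
               v G.⟶ v′ → w H.⟶ w′ → S (I.embed v′) (J.embed w′)
    even-odd {v} {w} e ◇v □w v⟶v′ w⟶w′ =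
      let m , max , v′≤m = G.Max-above v⟶v′
          y , e′ , w↠y = zig e (G.Ext⇒↠ ◇v (m , max , G.≡ᵈ-refl))
          x , minx , _ , y≤x = H.↠⇒Ext □w w↠y
          n , minn , n≤w′ = H.Min-below w⟶w′
          -- `x` is dictated by `zig`, `n` by the given `w′`; only a single minimal class links
          -- them.
          x≤n , _ = H.¬Multi⇒Min≡ᵈ □w ¬multi minx minn
      in E⇒S v′≤m e′ (H.≤ᵈ-trans y≤x (H.≤ᵈ-trans x≤n n≤w′))
      where
      ¬multi : ¬ H.Multi w
      ¬multi multi = ◇≢□ (trans (sym ◇v) (proj₁ (E⇒Multi e multi)))

    odd-odd : ∀ {v w w′} → E v w → G.𝒫 v ≡ □ → H.𝒫 w ≡ □ → w H.⟶ w′ →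
              ∃ λ v′ → v G.⟶ v′ × S (I.embed v′) (J.embed w′)
    odd-odd e □v □w w⟶w′ =
      let n , min , n≤w′ = H.Min-below w⟶w′
          x , e′ , v↠x = zag e (H.Ext⇒↠ □w (n , min , H.≡ᵈ-refl))
          v′ , (v⟶v′ , _) , v′≤x , _ = G.↠⇒Ext □v v↠x
      in v′ , v⟶v′ , E⇒S v′≤x e′ n≤w′

    odd-even : ∀ {v w} → E v w → G.𝒫 v ≡ □ → H.𝒫 w ≡ ◇ →
               ∃ λ v′ → v G.⟶ v′ × ∃ λ w′ → w H.⟶ w′ × S (I.embed v′) (J.embed w′)
    odd-even {w = w} e □v ◇w =
      -- Any successor will do as a start: the clause asks for just one related pair.
      let w₀ , w⟶w₀ = H.total w
          m , max , _ = H.Max-above w⟶w₀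
          x , e′ , v↠x = zag e (H.Ext⇒↠ ◇w (m , max , H.≡ᵈ-refl))
          v′ , (v⟶v′ , _) , v′≤x , _ = G.↠⇒Ext □v v↠x
      in v′ , v⟶v′ , m , proj₁ max , E⇒S v′≤x e′ H.≤ᵈ-refl

    forced : ∀ {v w} → E v w →
             (G.𝒫 v ≡ ◇ × ∀ {x} → I.embed v K.⟶ x → J.embed w K.⟶⟨ ◇ ⟩ S x)
           ⊎ (G.𝒫 v ≡ □ × J.embed w K.⟶⟨ ◇ ⟩ (I.embed v K.•) K.[ S ])
    forced {v} {w} e with G.𝒫 v in eqv | H.𝒫 w in eqw
    ... | ◇ | ◇ = inj₁ (refl , step)
      where
      step : ∀ {x} → I.embed v K.⟶ x → J.embed w K.⟶⟨ ◇ ⟩ S x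
      step f with v′ , refl ← I.⟶-lift f =
        let w′ , w⟶w′ , s = even-even e eqv eqw (I.⟶-reflects f)
        in inj₁ (trans (J.𝒫-pres w) eqw , J.embed w′ , J.⟶-pres w⟶w′ , s)
    ... | ◇ | □ = inj₁ (refl , λ f → inj₂ (odd , step f))
      where
      odd : K.𝒫 (J.embed w) ≢ ◇
      odd ◇w = ◇≢□ (trans (sym ◇w) (trans (J.𝒫-pres w) eqw))
      step : ∀ {x y} → I.embed v K.⟶ x → J.embed w K.⟶ y → S x y
      step f g with v′ , refl ← I.⟶-lift f | w′ , refl ← J.⟶-lift g =
        even-odd e eqv eqw (I.⟶-reflects f) (J.⟶-reflects g)
    ... | □ | □ = inj₂ (refl , inj₂ (odd , step))
      where
      odd : K.𝒫 (J.embed w) ≢ ◇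
      odd ◇w = ◇≢□ (trans (sym ◇w) (trans (J.𝒫-pres w) eqw))
      step : ∀ {y} → J.embed w K.⟶ y → ((I.embed v K.•) K.[ S ]) y
      step g with w′ , refl ← J.⟶-lift g =
        let v′ , v⟶v′ , s = odd-odd e eqv eqw (J.⟶-reflects g)
        in I.embed v′ , I.⟶-pres v⟶v′ , s
    ... | □ | ◇ =
      let v′ , v⟶v′ , w′ , w⟶w′ , s = odd-even e eqv eqw
      in inj₂ (refl , inj₁ ( trans (J.𝒫-pres w) eqw , J.embed w′
                           , J.⟶-pres w⟶w′ , I.embed v′ , I.⟶-pres v⟶v′ , s))

    -- A challenge at `x` passes through three stages: `≤ᵈ-isSim` up to `v`, `middle` across `E`,
    -- and `force-≤ᵈ` from `w` to `y`. The outer two are absorbed by `≤ᵈ-S` and `S-≤ᵈ`.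
    simS : K.IsSim S
    simS {x} {y} (v , w , x≤v , e , w≤y) =
        trans (K.≤ᵈ⇒Ω≡ x≤v) (trans (I.Ω-pres v)
          (trans (E⇒Ω e) (trans (sym (J.Ω-pres w)) (K.≤ᵈ⇒Ω≡ w≤y))))
      , (λ ◇x {x′} f → through (λ (u , x′≤u , s) → ≤ᵈ-S x′≤u s)
                               (proj₁ (proj₂ (K.≤ᵈ-isSim x≤v)) ◇x f))
      , (λ □x → through (λ (u , (x′ , f , x′≤u) , s) → x′ , f , ≤ᵈ-S x′≤u s)
                        (proj₂ (proj₂ (K.≤ᵈ-isSim x≤v)) □x))
      where
      middle : ∀ {ℓ} {T : Pred K.V ℓ} → I.embed v K.⟶⟨ ◇ ⟩ T →
               J.embed w K.⟶⟨ ◇ ⟩ T K.[ S ]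
      middle f with forced e
      ... | inj₁ (◇v , h) =
        let u , v⟶u , t = K.forced-by-◇ (trans (I.𝒫-pres v) ◇v) f
        in K.⟶⟨⟩-mono (λ s → u , t , s) (h v⟶u)
      ... | inj₂ (□v , h) =
        K.⟶⟨⟩-mono (λ (u , v⟶u , s) →
          u , K.forced-by-□ (trans (I.𝒫-pres v) □v) f v⟶u , s) h

      through : ∀ {ℓ ℓ′} {T : Pred K.V ℓ} {U : Pred K.V ℓ′} →
                (∀ {z} → (T K.[ S ]) z → U z) →
                I.embed v K.⟶⟨ ◇ ⟩ T → y K.⟶⟨ ◇ ⟩ U
      through T⇒U f = K.⟶⟨⟩-mono
        (λ (z , (u , t , s) , z≤) → T⇒U (u , t , S-≤ᵈ s z≤))
        (K.force-≤ᵈ w≤y (middle f))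

-- The two directions of the equivalence.

module _ (G H : ParityGame) where
  private
    module G = Properties G
    module H = Properties H
    module U = Properties (G ⊎ᴳ H)
    module I = Embedding (inj₁-embedding G H)
    module J = Embedding (inj₂-embedding G H)

  -- `left` chooses a partner for each vertex. Each property is embedded into the disjoint union,
  -- moved along `v≡to`, and reflected into the other game.
  ≡ᵈᴳ⇒≅ : G ≡ᵈᴳ H → G /≡ᵈ ≅ H /≡ᵈ
  ≡ᵈᴳ⇒≅ (left , right) = record
    { bijection = record
      { to        = to
      ; cong      = λ {v} {w} v≡w → J.≡ᵈ-reflects
          (U.≡ᵈ-trans (U.≡ᵈ-sym (v≡to v)) (U.≡ᵈ-trans (I.≡ᵈ-pres v≡w) (v≡to w)))
      ; bijective = injective , λ w → let v , v≡w = right w in v , λ {z} z≡v →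
          J.≡ᵈ-reflects (U.≡ᵈ-trans (U.≡ᵈ-sym (v≡to z))
                                    (U.≡ᵈ-trans (I.≡ᵈ-pres z≡v) v≡w))
      }
    ; Ω-preserved = λ c → trans (H.Ωq≡Ω (to c))
        (trans (sym (U.≤ᵈ⇒Ω≡ (proj₁ (v≡to c)))) (sym (G.Ωq≡Ω c)))
    ; 𝒫-preserved = λ c → cong (λ b → if b then □ else ◇) (does-⇔
        (mk⇔ (G.Multi⇒OddOwned ∘ I.Multi-reflects ∘ U.Multi-resp (U.≡ᵈ-sym (v≡to c))
                ∘ J.Multi-pres ∘ H.OddOwned⇒Multi)
             (H.Multi⇒OddOwned ∘ J.Multi-reflects ∘ U.Multi-resp (v≡to c)
                ∘ I.Multi-pres ∘ G.OddOwned⇒Multi))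
        (H.OddOwned? (to c)) (G.OddOwned? c))
    ; ⟶-preserved = λ c d → mk⇔
        (λ c⟶d → H.↠⇒⟶q (J.↠-reflects (U.↠-respʳ (inj₂ (to c)) (v≡to d)
          (U.↠-resp (v≡to c) (I.↠-pres (G.⟶q⇒↠ c⟶d))))))
        (λ c⟶d → G.↠⇒⟶q (I.↠-reflects (U.↠-respʳ (inj₁ c) (U.≡ᵈ-sym (v≡to d))
          (U.↠-resp (U.≡ᵈ-sym (v≡to c)) (J.↠-pres (H.⟶q⇒↠ c⟶d))))))
    }
    where
    to : G.V → H.V
    to v = proj₁ (left v)
    v≡to : ∀ v → inj₁ v U.≡ᵈ inj₂ (to v)
    v≡to v = proj₂ (left v)
    injective : ∀ {v w} → to v H.≡ᵈ to w → v G.≡ᵈ w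
    injective {v} {w} tv≡tw = I.≡ᵈ-reflects
      (U.≡ᵈ-trans (v≡to v) (U.≡ᵈ-trans (J.≡ᵈ-pres tv≡tw) (U.≡ᵈ-sym (v≡to w))))

  -- The graph of the bijection, closed under `_≡ᵈ_` on the right, satisfies the back-and-forth
  -- conditions symmetrically, so `correspondence⇒≤ᵈ` applies to it and to its converse.
  ≅⇒≡ᵈᴳ : G /≡ᵈ ≅ H /≡ᵈ → G ≡ᵈᴳ H
  ≅⇒≡ᵈᴳ iso =
      (λ v → f.to v , E⇒≡ᵈ H.≡ᵈ-refl)
    , (λ w → let v , to≡w = f.surjective w in v , E⇒≡ᵈ (to≡w G.≡ᵈ-refl))
    where
    open _≅_ iso
    module f = Bijection bijection

    E : G.V → H.V → Set₁
    E v w = f.to v H.≡ᵈ w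

    E? : ∀ v w → Dec (E v w)
    E? v w = f.to v H.≡ᵈ? w

    E⇒Ω : ∀ {v w} → E v w → G.Ω v ≡ H.Ω w
    E⇒Ω {v} (tv≤w , _) = trans (sym (G.Ωq≡Ω v)) (trans (sym (Ω-preserved v))
      (trans (H.Ωq≡Ω (f.to v)) (H.≤ᵈ⇒Ω≡ tv≤w)))

    E⇒Multi : ∀ {v w} → E v w → G.Multi v → H.Multi w
    E⇒Multi {v} e multi = H.Multi-resp e (H.OddOwned⇒Multi
      (owner-reflects (G.OddOwned? v) (H.OddOwned? (f.to v))
        (sym (𝒫-preserved v)) (G.Multi⇒OddOwned multi)))

    E⇒Multi˘ : ∀ {v w} → E v w → H.Multi w → G.Multi v
    E⇒Multi˘ {v} e multi = G.OddOwned⇒Multi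
      (owner-reflects (H.OddOwned? (f.to v)) (G.OddOwned? v) (𝒫-preserved v)
        (H.Multi⇒OddOwned (H.Multi-resp (H.≡ᵈ-sym e) multi)))

    zig : ∀ {v w x} → E v w → v G.↠ x → ∃ λ y → E x y × w H.↠ y
    zig {v} {w} {x} e v↠x = f.to x , H.≡ᵈ-refl
      , H.↠-resp e (H.⟶q⇒↠ (Equivalence.to (⟶-preserved v x) (G.↠⇒⟶q v↠x)))

    zag : ∀ {v w y} → E v w → w H.↠ y → ∃ λ x → E x y × v G.↠ x
    zag {v} {w} {y} e w↠y =
      -- The preimage is exact only up to `_≡ᵈ_`, so both ends of the edge are adjusted before
      -- `⟶-preserved` is read backwards.
      let x , to≡y = f.surjective y
          tx≡y = to≡y G.≡ᵈ-refl
      in x , tx≡y , G.⟶q⇒↠ (Equivalence.from (⟶-preserved v x)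
           (H.↠⇒⟶q (H.↠-respʳ (f.to v) (H.≡ᵈ-sym tx≡y) (H.↠-resp (H.≡ᵈ-sym e) w↠y))))

    E⇒≡ᵈ : ∀ {v w} → E v w → inj₁ v U.≡ᵈ inj₂ w
    E⇒≡ᵈ e =
        correspondence⇒≤ᵈ (inj₁-embedding G H) (inj₂-embedding G H)
          E E? E⇒Ω E⇒Multi˘ zig zag e
      , correspondence⇒≤ᵈ (inj₂-embedding G H) (inj₁-embedding G H)
          (flip E) (flip E?) (sym ∘ E⇒Ω) E⇒Multi zag zig e

theorem13 : (G G′ : ParityGame) → (G ≡ᵈᴳ G′) ⇔ (G /≡ᵈ ≅ G′ /≡ᵈ)
theorem13 G G′ = mk⇔ (≡ᵈᴳ⇒≅ G G′) (≅⇒≡ᵈᴳ G G′)
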